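{- Let $M=(\mathcal{A},\mathrm{rk})$ be a matroid and let $k\ge 1$. Then $$\chi^k_M(t_1,\dots,t_k)=(-1)^{k\,\mathrm{rk}(M)}\,W^k_M(-t_1,\dots,-t_k;\,-1,\dots,-1)=(-1)^{k\,\mathrm{rk}(M)}\,T^k_M(1-t_1,\dots,1-t_k;\,0,\dots,0).$$
   Context: A matroid $M=(\mathcal{A},\mathrm{rk})$ is given by a finite ground set $\mathcal{A}$ and its rank function $\mathrm{rk}:2^{\mathcal{A}}\to\mathbb{N}$; $\mathrm{rk}(M)=\mathrm{rk}(\mathcal{A})$. For $k\ge 1$ let $\mathcal{C}^k_{\mathcal{A}}=\{(A_1,\dots,A_k)\in(2^{\mathcal{A}})^k \mid A_1\subseteq A_2\subseteq\cdots\subseteq A_k\subseteq\mathcal{A}\}$ (inclusions need not be strict). The $k$th chain characteristic polynomial is $\chi_M^k(t_1,\dots,t_k)=\sum_{(A_i)\in\mathcal{C}^k_{\mathcal{A}}}\prod_{i=1}^k(-1)^{|A_i|}t_i^{\mathrm{rk}(M)-\mathrm{rk}(A_i)}$. The $k$th chain Whitney rank generating polynomial is $W^k_M(a_1,\dots,a_k;b_1,\dots,b_k)=\sum_{(S_i)\in\mathcal{C}^k_{\mathcal{A}}}\prod_{i=1}^k a_i^{\mathrm{rk}(M)-\mathrm{rk}(S_i)}b_i^{|S_i|-\mathrm{rk}(S_i)}$. The $k$th chain Tutte polynomial is $T^k_M(x_1,\dots,x_k;y_1,\dots,y_k)=W^k_M(x_1-1,\dots,x_k-1;y_1-1,\dots,y_k-1)$.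 -}

module Defs where

open import Algebra.Bundles.Raw using (RawRing)
import Algebra.Definitions.RawSemiring as RawSemiringOps
open import Data.Bool.Base using (if_then_else_)
open import Data.Fin.Base using (Fin; _↑ˡ_; _↑ʳ_)
open import Data.Fin.Subset using (Subset; inside; outside; ⊤; _⊆_; _∪_; _∩_; ∣_∣)
open import Data.Fin.Subset.Properties using (_⊆?_)
open import Data.Integer.Base as ℤ using (ℤ)
open import Data.List.Base as List using (List; []; _∷_; _++_; map; foldr; filter; cartesianProductWith)
open import Data.Nat.Base as ℕ using (ℕ; zero; suc; _≤_; _∸_)
import Data.Nat.Properties as ℕ
open import Data.Product.Base using (_×_; _,_)
open import Data.Vec.Base as Vec using (Vec; lookup; zipWith; replicate; _[_]≔_)
import Data.Vec.Functional as Vector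
open import Data.Vec.Functional using (Vector)
open import Data.Vec.Properties using (≡-dec)
open import Data.Vec.Relation.Unary.Linked using (Linked; linked?)
open import Level using (0ℓ)
open import Relation.Binary.Definitions using (DecidableEquality)
open import Relation.Binary.PropositionalEquality using (_≡_)
open import Relation.Nullary.Decidable using (does)

Monomial : ℕ → Set
Monomial n = Vec ℕ n

_≟ᵐ_ : ∀ {n} → DecidableEquality (Monomial n)
_≟ᵐ_ = ≡-dec ℕ._≟_

-- A polynomial is presented as a formal sum of terms c · X^e.  Terms may
-- repeat or have coefficient zero, so the equality of polynomials is _≈_
-- below (all coefficients agree), not _≡_.
Poly : ℕ → Set
Poly n = List (ℤ × Monomial n)

coeff : ∀ {n} → Poly n → Monomial n → ℤ
coeff []            m = ℤ.+ 0
coeff ((c , e) ∷ p) m = (if does (e ≟ᵐ m) then c else ℤ.+ 0) ℤ.+ coeff p m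

infix  4 _≈_
infixl 6 _+_ _-_
infixl 7 _*_
infix  8 -_

_≈_ : ∀ {n} → Poly n → Poly n → Set
p ≈ q = ∀ m → coeff p m ≡ coeff q m

const : ∀ {n} → ℤ → Poly n
const c = (c , replicate _ 0) ∷ []

X : ∀ {n} → Fin n → Poly n
X i = (ℤ.+ 1 , replicate _ 0 [ i ]≔ 1) ∷ []

0# : ∀ {n} → Poly n
0# = []

1# : ∀ {n} → Poly n
1# = const (ℤ.+ 1)

_+_ : ∀ {n} → Poly n → Poly n → Poly n
_+_ = _++_

-_ : ∀ {n} → Poly n → Poly n
-_ = map λ (c , e) → ℤ.- c , e

_-_ : ∀ {n} → Poly n → Poly n → Poly n
p - q = p + - q

_*_ : ∀ {n} → Poly n → Poly n → Poly n
_*_ = cartesianProductWith λ (c , e) (d , f) → c ℤ.* d , zipWith ℕ._+_ e f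

polyRing : ℕ → RawRing 0ℓ 0ℓ
polyRing n = record
  { Carrier = Poly n
  ; _≈_     = _≈_
  ; _+_     = _+_
  ; _*_     = _*_
  ; -_      = -_
  ; 0#      = 0#
  ; 1#      = 1#
  }

private
  module Ops {n} = RawSemiringOps (RawRing.rawSemiring (polyRing n))

open Ops public using (_^_; product)

sumList : ∀ {n} → List (Poly n) → Poly n
sumList = foldr _+_ 0#

-- Substitution of σ i for Xᵢ.
infix 9 _[_]
_[_] : ∀ {m n} → Poly m → Vector (Poly n) m → Poly n
p [ σ ] = sumList (map (λ (c , e) → const c * product (λ i → σ i ^ lookup e i)) p)

record Matroid (n : ℕ) : Set where
  field
    rk            : Subset n → ℕ
    rk-bounded    : ∀ A → rk A ≤ ∣ A ∣
    rk-monotone   : ∀ {A B} → A ⊆ B → rk A ≤ rk B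
    rk-submodular : ∀ A B → rk (A ∪ B) ℕ.+ rk (A ∩ B) ≤ rk A ℕ.+ rk B

  rank : ℕ
  rank = rk ⊤

vectors : ∀ {A : Set} → List A → ∀ k → List (Vec A k)
vectors xs zero    = Vec.[] ∷ []
vectors xs (suc k) = cartesianProductWith Vec._∷_ xs (vectors xs k)

subsets : ∀ n → List (Subset n)
subsets = vectors (inside ∷ outside ∷ [])

-- All A₁ ⊆ A₂ ⊆ ⋯ ⊆ Aₖ, inclusions not necessarily strict, each listed once.
chains : ∀ n k → List (Vec (Subset n) k)
chains n k = filter (linked? _⊆?_) (vectors (subsets n) k)

∑-chains : ∀ {n k m} → (Vec (Subset n) k → Poly m) → Poly m
∑-chains {n} {k} f = sumList (map f (chains n k))

-- The truncated subtractions in the exponents never truncate: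
-- rk A ≤ rank M by monotonicity and rk A ≤ ∣ A ∣ by boundedness.
module _ {n : ℕ} (M : Matroid n) (k : ℕ) where
  open Matroid M

  -- The variables are t₁, …, tₖ.
  χ : Poly k
  χ = ∑-chains λ A → product {n = k} λ i →
        (- 1#) ^ ∣ lookup A i ∣ * X i ^ (rank ∸ rk (lookup A i))

  -- The variables are a₁, …, aₖ followed by b₁, …, bₖ.
  W : Poly (k ℕ.+ k)
  W = ∑-chains λ S → product {n = k ℕ.+ k} λ i →
        X (i ↑ˡ k) ^ (rank ∸ rk (lookup S i)) *
        X (k ↑ʳ i) ^ (∣ lookup S i ∣ ∸ rk (lookup S i))

  -- The variables are x₁, …, xₖ followed by y₁, …, yₖ.
  T : Poly (k ℕ.+ k)
  T = W [ (λ i → X (i ↑ˡ k) - 1#) Vector.++ (λ i → X (k ↑ʳ i) - 1#) ]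

{-# OPTIONS --safe #-}

-- A polynomial p = Σ c·X^e is read as the linear functional φ ↦ Σ c·φ(e) on
-- ℤ-valued functions of the exponent.  The coefficients are the values at the
-- delta functions and determine the functional, so ring laws for _≈_ and the
-- homomorphism property of substitution become identities between double sums.
-- After that the theorem is a comparison of factors: rk(M) = a + rk(Aᵢ) and
-- ∣Aᵢ∣ = b + rk(Aᵢ) give rk(M) + (a + b) = ∣Aᵢ∣ + 2a, hence
-- (-1)^rk(M) · (-t)^a · (-1)^b = (-1)^∣Aᵢ∣ · t^a.

module Submission where

open import Algebra.Bundles using (Monoid; Semiring; CommutativeRing)
open import Algebra.Definitions.RawMonoid using (sum) renaming (_×_ to multiple)
import Algebra.Definitions.RawSemiring as RawSemiringOps
open import Algebra.Morphism.Structures using (module MonoidMorphisms; module RingMorphisms)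
import Algebra.Properties.CommutativeMonoid.Sum as CommutativeMonoidSum
import Algebra.Properties.CommutativeSemigroup as CommutativeSemigroupProperties
import Algebra.Properties.CommutativeSemiring.Exp as Exp
import Algebra.Properties.Group as GroupProperties
import Algebra.Properties.Ring as RingProperties
open import Data.Bool.Base using (if_then_else_)
open import Data.Fin.Base using (Fin; zero; suc; splitAt; _↑ˡ_; _↑ʳ_)
open import Data.Fin.Subset using (Subset; ∣_∣)
open import Data.Fin.Subset.Properties using (⊆-max)
open import Data.Integer.Base as ℤ using (ℤ)
import Data.Integer.Properties as ℤ
open import Data.List.Base using ([]; _∷_; map; foldr)
open import Data.List.Properties using (++-assoc; ++-identityʳ)
open import Data.List.Membership.Propositional using (_∈_)
open import Data.List.Membership.Propositional.Properties using (∈-map⁺)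
open import Data.List.Relation.Unary.All as All using (All; []; _∷_)
open import Data.List.Relation.Unary.Any using (here; there)
open import Data.Nat.Base as ℕ using (ℕ; zero; suc; _∸_)
import Data.Nat.Properties as ℕ
open import Data.Nat.Solver using (module +-*-Solver)
open import Data.Product.Base using (_×_; _,_; proj₂)
open import Data.Sum.Base using (inj₁; inj₂)
open import Data.Vec.Base using (Vec; lookup; zipWith; replicate; _[_]≔_; []; _∷_)
open import Data.Vec.Functional using (Vector; _++_)
open import Data.Vec.Functional.Properties using (lookup-++ˡ; lookup-++ʳ)
import Data.Vec.Properties as Vec
open import Function.Base using (_∘_)
open import Level using (0ℓ)
open import Relation.Binary.PropositionalEquality
  using (_≡_; refl; sym; trans; cong; cong₂; module ≡-Reasoning)
open import Relation.Binary.Structures using (IsEquivalence)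
import Relation.Binary.Reasoning.Setoid as SetoidReasoning
open import Relation.Nullary.Decidable using (does; yes; no)
open import Relation.Nullary.Negation using (contradiction)

-- Monoid homomorphisms and iterated operations.

module _ {a b ℓ₁ ℓ₂} (M : Monoid a ℓ₁) (N : Monoid b ℓ₂) where
  private
    module M = Monoid M
    module N = Monoid N
  open MonoidMorphisms M.rawMonoid N.rawMonoid

  -- Working with monoids serves both structures of a ring: multiplicatively, `sum` becomes
  -- `product` and `multiple` becomes a power; additively, `foldr` is the sum over a list.
  module MonoidHomomorphism {h} (isHom : IsMonoidHomomorphism h) where
    open IsMonoidHomomorphism isHom

    sum-homo : ∀ {n} (v : Vector M.Carrier n) →
               h (sum M.rawMonoid v) N.≈ sum N.rawMonoid (h ∘ v)
    sum-homo {zero}  v = ε-homo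
    sum-homo {suc n} v = N.trans (homo _ _) (N.∙-congˡ (sum-homo (v ∘ suc)))

    multiple-homo : ∀ n x → h (multiple M.rawMonoid n x) N.≈ multiple N.rawMonoid n (h x)
    multiple-homo zero    x = ε-homo
    multiple-homo (suc n) x = N.trans (homo _ _) (N.∙-congˡ (multiple-homo n x))

    foldr-map-homo : ∀ {A : Set} (f : A → M.Carrier) xs →
      h (foldr M._∙_ M.ε (map f xs)) N.≈ foldr N._∙_ N.ε (map (h ∘ f) xs)
    foldr-map-homo f []       = ε-homo
    foldr-map-homo f (x ∷ xs) = N.trans (homo _ _) (N.∙-congˡ (foldr-map-homo f xs))

-- Monomials and signs in a commutative ring.

module CommutativeRingLemmas {c ℓ} (R : CommutativeRing c ℓ) where
  open CommutativeRing R hiding (zero) renaming (sym to ≈-sym; trans to ≈-trans; refl to ≈-refl)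
  open RawSemiringOps (Semiring.rawSemiring semiring) using (_^_; product)
  open Exp commutativeSemiring public using (^-congˡ; ^-congʳ; ^-homo-*; ^-distrib-*)
  open RingProperties ring using (-1*x≈-x)
  open GroupProperties +-group using (⁻¹-involutive)
  open CommutativeSemigroupProperties *-commutativeSemigroup using (interchange)
  open CommutativeMonoidSum *-commutativeMonoid public using ()
    renaming (sum-cong-≋ to product-cong; ∑-distrib-+ to product-distrib-*)
  open SetoidReasoning setoid

  -- Over the polynomial ring this is definitionally the product occurring in `_[_]`.
  monomial : ∀ {n} → Vector Carrier n → Vec ℕ n → Carrier
  monomial x e = product (λ i → x i ^ lookup e i)

  monomial-cong : ∀ {n} {x y : Vector Carrier n} → (∀ i → x i ≈ y i) →
                  ∀ e → monomial x e ≈ monomial y e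
  monomial-cong x≈y e = product-cong (λ i → ^-congˡ (lookup e i) (x≈y i))

  monomial-+ : ∀ {n} (x : Vector Carrier n) e f →
               monomial x (zipWith ℕ._+_ e f) ≈ monomial x e * monomial x f
  monomial-+ x e f = ≈-trans
    (product-cong λ i → ≈-trans
      (^-congʳ (x i) (Vec.lookup-zipWith ℕ._+_ i e f))
      (^-homo-* (x i) (lookup e i) (lookup f i)))
    (product-distrib-* (λ i → x i ^ lookup e i) (λ i → x i ^ lookup f i))

  monomial-0 : ∀ {n} (x : Vector Carrier n) → monomial x (replicate n 0) ≈ 1#
  monomial-0 {zero}  x = ≈-refl
  monomial-0 {suc n} x = ≈-trans (*-identityˡ _) (monomial-0 (x ∘ suc))

  monomial-unit : ∀ {n} (x : Vector Carrier n) i →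
                  monomial x (replicate n 0 [ i ]≔ 1) ≈ x i
  monomial-unit x zero    =
    ≈-trans (*-cong (*-identityʳ _) (monomial-0 (x ∘ suc))) (*-identityʳ _)
  monomial-unit x (suc i) = ≈-trans (*-identityˡ _) (monomial-unit (x ∘ suc) i)

  foldr-map-cong : ∀ {A : Set} {f g : A → Carrier} → (∀ x → f x ≈ g x) →
                   ∀ xs → foldr _+_ 0# (map f xs) ≈ foldr _+_ 0# (map g xs)
  foldr-map-cong f≈g []       = ≈-refl
  foldr-map-cong f≈g (x ∷ xs) = +-cong (f≈g x) (foldr-map-cong f≈g xs)

  *-distribˡ-foldr-map : ∀ {A : Set} y (f : A → Carrier) xs →
    y * foldr _+_ 0# (map f xs) ≈ foldr _+_ 0# (map (λ x → y * f x) xs)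
  *-distribˡ-foldr-map y f []       = zeroʳ y
  *-distribˡ-foldr-map y f (x ∷ xs) =
    ≈-trans (distribˡ y _ _) (+-congˡ (*-distribˡ-foldr-map y f xs))

  1^n≈1 : ∀ n → 1# ^ n ≈ 1#
  1^n≈1 zero    = ≈-refl
  1^n≈1 (suc n) = ≈-trans (*-identityˡ _) (1^n≈1 n)

  [-1]^[n+n]≈1 : ∀ n → (- 1#) ^ (n ℕ.+ n) ≈ 1#
  [-1]^[n+n]≈1 n = begin
    (- 1#) ^ (n ℕ.+ n)       ≈⟨ ^-homo-* (- 1#) n n ⟩
    (- 1#) ^ n * (- 1#) ^ n  ≈⟨ ^-distrib-* (- 1#) (- 1#) n ⟨
    (- 1# * - 1#) ^ n        ≈⟨ ^-congˡ n (≈-trans (-1*x≈-x (- 1#)) (⁻¹-involutive 1#)) ⟩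
    1# ^ n                   ≈⟨ 1^n≈1 n ⟩
    1#                       ∎

  [-x]^n≈[-1]^n*x^n : ∀ x n → (- x) ^ n ≈ (- 1#) ^ n * x ^ n
  [-x]^n≈[-1]^n*x^n x n = ≈-trans (^-congˡ n (≈-sym (-1*x≈-x x))) (^-distrib-* (- 1#) x n)

  -- Writing `(- x) ^ a` as `(- 1#) ^ a * x ^ a` collects all signs into the exponent r + (a + b).
  -- The hypothesis turns it into s + 2a, and the even part contributes 1.
  absorb-signs : ∀ x {r s a b} → r ℕ.+ (a ℕ.+ b) ≡ s ℕ.+ (a ℕ.+ a) →
                 (- 1#) ^ r * ((- x) ^ a * (- 1#) ^ b) ≈ (- 1#) ^ s * x ^ a
  absorb-signs x {r} {s} {a} {b} r+a+b≡s+2a = begin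
    (- 1#) ^ r * ((- x) ^ a * (- 1#) ^ b)
      ≈⟨ *-congˡ (*-congʳ ([-x]^n≈[-1]^n*x^n x a)) ⟩
    (- 1#) ^ r * (((- 1#) ^ a * x ^ a) * (- 1#) ^ b)
      ≈⟨ *-congˡ (*-assoc _ _ _) ⟩
    (- 1#) ^ r * ((- 1#) ^ a * (x ^ a * (- 1#) ^ b))
      ≈⟨ *-congˡ (*-congˡ (*-comm _ _)) ⟩
    (- 1#) ^ r * ((- 1#) ^ a * ((- 1#) ^ b * x ^ a))
      ≈⟨ *-congˡ (*-assoc _ _ _) ⟨
    (- 1#) ^ r * (((- 1#) ^ a * (- 1#) ^ b) * x ^ a)
      ≈⟨ *-assoc _ _ _ ⟨
    ((- 1#) ^ r * ((- 1#) ^ a * (- 1#) ^ b)) * x ^ a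
      ≈⟨ *-congʳ (*-congˡ (^-homo-* (- 1#) a b)) ⟨
    ((- 1#) ^ r * (- 1#) ^ (a ℕ.+ b)) * x ^ a
      ≈⟨ *-congʳ (^-homo-* (- 1#) r (a ℕ.+ b)) ⟨
    (- 1#) ^ (r ℕ.+ (a ℕ.+ b)) * x ^ a
      ≈⟨ *-congʳ (^-congʳ (- 1#) r+a+b≡s+2a) ⟩
    (- 1#) ^ (s ℕ.+ (a ℕ.+ a)) * x ^ a
      ≈⟨ *-congʳ (^-homo-* (- 1#) s (a ℕ.+ a)) ⟩
    ((- 1#) ^ s * (- 1#) ^ (a ℕ.+ a)) * x ^ a
      ≈⟨ *-congʳ (*-congˡ ([-1]^[n+n]≈1 a)) ⟩
    ((- 1#) ^ s * 1#) * x ^ a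
      ≈⟨ *-congʳ (*-identityʳ _) ⟩
    (- 1#) ^ s * x ^ a ∎

  -- Serves to hand one copy of the global sign `(- 1#) ^ r` to each of the k factors of a chain's
  -- product, so that signs can be compared factor by factor.
  ^-*-product : ∀ {k} x r (v : Vector Carrier k) →
                x ^ (k ℕ.* r) * product v ≈ product (λ i → x ^ r * v i)
  ^-*-product {zero}  x r v = *-identityˡ _
  ^-*-product {suc k} x r v = begin
    x ^ (r ℕ.+ k ℕ.* r) * (v zero * product (v ∘ suc))
      ≈⟨ *-congʳ (^-homo-* x r (k ℕ.* r)) ⟩
    (x ^ r * x ^ (k ℕ.* r)) * (v zero * product (v ∘ suc))
      ≈⟨ interchange _ _ _ _ ⟩
    (x ^ r * v zero) * (x ^ (k ℕ.* r) * product (v ∘ suc))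
      ≈⟨ *-congˡ (^-*-product x r (v ∘ suc)) ⟩
    (x ^ r * v zero) * product (λ i → x ^ r * v (suc i)) ∎

  -- The first equality of the theorem with the matroid abstracted away: only the parity relation
  -- between the exponents r, a, b and s matters. The bases `u` and `v` are given up to `_≈_`
  -- because they will be entries of a concatenated vector.
  sum-of-products-signs : ∀ {A : Set} {k} {u v x : Vector Carrier k} {a b s : A → Fin k → ℕ} {r} →
    (∀ i → u i ≈ - x i) → (∀ i → v i ≈ - 1#) →
    (∀ y i → r ℕ.+ (a y i ℕ.+ b y i) ≡ s y i ℕ.+ (a y i ℕ.+ a y i)) → ∀ xs →
    (- 1#) ^ (k ℕ.* r) *
      foldr _+_ 0# (map (λ y → product (λ i → u i ^ a y i * v i ^ b y i)) xs) ≈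
    foldr _+_ 0# (map (λ y → product (λ i → (- 1#) ^ s y i * x i ^ a y i)) xs)
  sum-of-products-signs {u = u} {v} {x} {a} {b} {s} {r} u≈-x v≈-1 r+a+b≡s+2a xs = ≈-trans
    (*-distribˡ-foldr-map _ (λ y → product (λ i → u i ^ a y i * v i ^ b y i)) xs)
    (foldr-map-cong (λ y → ≈-trans
      (^-*-product (- 1#) r (λ i → u i ^ a y i * v i ^ b y i))
      (product-cong λ i → ≈-trans
        (*-congˡ (*-cong (^-congˡ (a y i) (u≈-x i)) (^-congˡ (b y i) (v≈-1 i))))
        (absorb-signs (x i) {r} {s y i} {a y i} {b y i} (r+a+b≡s+2a y i)))) xs)

  -- With x = 1 this is (1 - t) - 1 = -t, the shift between the arguments of `T` and those of `W`.
  [x-y]-x≈-y : ∀ x y → (x - y) - x ≈ - y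
  [x-y]-x≈-y x y = begin
    (x + - y) + - x  ≈⟨ +-congʳ (+-comm x (- y)) ⟩
    (- y + x) + - x  ≈⟨ +-assoc _ _ _ ⟩
    - y + (x + - x)  ≈⟨ +-congˡ (-‿inverseʳ x) ⟩
    - y + 0#         ≈⟨ +-identityʳ _ ⟩
    - y              ∎

  -- The left-hand side is the shape that `_[_]` produces from a single term with coefficient 1.
  1*x+0≈y : ∀ {x y} → x ≈ y → 1# * x + 0# ≈ y
  1*x+0≈y x≈y = ≈-trans (+-identityʳ _) (≈-trans (*-identityˡ _) x≈y)

-- Ring homomorphisms applied to monomials and sums of products.

module RingHomomorphism {c ℓ c′ ℓ′} (R : CommutativeRing c ℓ) (S : CommutativeRing c′ ℓ′) where
  private
    module R where
      open CommutativeRing R public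
      open CommutativeRingLemmas R public
      open RawSemiringOps (Semiring.rawSemiring semiring) public using (_^_; product)
    module S where
      open CommutativeRing S public
      open CommutativeRingLemmas S public
      open RawSemiringOps (Semiring.rawSemiring semiring) public using (_^_; product)
  open RingMorphisms R.rawRing S.rawRing

  module _ {h} (isHom : IsRingHomomorphism h) where
    open IsRingHomomorphism isHom
    open MonoidHomomorphism R.*-monoid S.*-monoid *-isMonoidHomomorphism
      using () renaming (sum-homo to product-homo; multiple-homo to ^-homo)
    open MonoidHomomorphism R.+-monoid S.+-monoid +-isMonoidHomomorphism
      using (foldr-map-homo)

    monomial-homo : ∀ {n} (x : Vector R.Carrier n) e →
                    h (R.monomial x e) S.≈ S.monomial (h ∘ x) e
    monomial-homo x e = S.trans (product-homo (λ i → x i R.^ lookup e i))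
      (S.product-cong (λ i → ^-homo (lookup e i) (x i)))

    -- The sum over `zs` has the shape of `W`. The images of the bases are prescribed up to `_≈_`,
    -- since substituting into a variable gives the substituted polynomial only up to `_≈_`.
    sum-of-products-homo : ∀ {A : Set} {k} {x y : Vector R.Carrier k} {x′ y′ : Vector S.Carrier k}
      {a b : A → Fin k → ℕ} → (∀ i → h (x i) S.≈ x′ i) → (∀ i → h (y i) S.≈ y′ i) → ∀ zs →
      h (foldr R._+_ R.0# (map (λ z → R.product (λ i → x i R.^ a z i R.* y i R.^ b z i)) zs)) S.≈
      foldr S._+_ S.0# (map (λ z → S.product (λ i → x′ i S.^ a z i S.* y′ i S.^ b z i)) zs)
    sum-of-products-homo {x = x} {y} {a = a} {b} hx≈x′ hy≈y′ zs = S.trans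
      (foldr-map-homo (λ z → R.product (factor z)) zs)
      (S.foldr-map-cong (λ z → S.trans (product-homo (factor z)) (S.product-cong λ i → S.trans
        (*-homo _ _)
        (S.*-cong
          (S.trans (^-homo (a z i) (x i)) (S.^-congˡ (a z i) (hx≈x′ i)))
          (S.trans (^-homo (b z i) (y i)) (S.^-congˡ (b z i) (hy≈y′ i)))))) zs)
      where
      factor : _ → Vector R.Carrier _
      factor z i = x i R.^ a z i R.* y i R.^ b z i

    x-1-homo : ∀ {x x′} → h x S.≈ x′ → h (x R.- R.1#) S.≈ x′ S.- S.1#
    x-1-homo hx≈x′ = S.trans (+-homo _ _)
      (S.+-cong hx≈x′ (S.trans (-‿homo _) (S.-‿cong 1#-homo)))

open import Defs

-- Polynomials as linear functionals on functions of the exponent.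

pair : ∀ {n} → Poly n → (Monomial n → ℤ) → ℤ
pair []            φ = ℤ.0ℤ
pair ((c , e) ∷ p) φ = c ℤ.* φ e ℤ.+ pair p φ

pair-cong : ∀ {n} (p : Poly n) {φ ψ} → (∀ e → φ e ≡ ψ e) → pair p φ ≡ pair p ψ
pair-cong []            φ≗ψ = refl
pair-cong ((c , e) ∷ p) φ≗ψ = cong₂ ℤ._+_ (cong (c ℤ.*_) (φ≗ψ e)) (pair-cong p φ≗ψ)

module +ℤ = CommutativeSemigroupProperties ℤ.+-commutativeSemigroup
module *ℤ = CommutativeSemigroupProperties ℤ.*-commutativeSemigroup

pair-zero : ∀ {n} (p : Poly n) → pair p (λ _ → ℤ.0ℤ) ≡ ℤ.0ℤ
pair-zero []            = refl
pair-zero ((c , e) ∷ p) = cong₂ ℤ._+_ (ℤ.*-zeroʳ c) (pair-zero p)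

pair-add : ∀ {n} (p : Poly n) φ ψ →
           pair p (λ e → φ e ℤ.+ ψ e) ≡ pair p φ ℤ.+ pair p ψ
pair-add []            φ ψ = refl
pair-add ((c , e) ∷ p) φ ψ = trans
  (cong₂ ℤ._+_ (ℤ.*-distribˡ-+ c (φ e) (ψ e)) (pair-add p φ ψ))
  (+ℤ.interchange (c ℤ.* φ e) (c ℤ.* ψ e) (pair p φ) (pair p ψ))

pair-scale : ∀ {n} (p : Poly n) d φ → pair p (λ e → d ℤ.* φ e) ≡ d ℤ.* pair p φ
pair-scale []            d φ = sym (ℤ.*-zeroʳ d)
pair-scale ((c , e) ∷ p) d φ = trans
  (cong₂ ℤ._+_ (*ℤ.x∙yz≈y∙xz c d (φ e)) (pair-scale p d φ))
  (sym (ℤ.*-distribˡ-+ d (c ℤ.* φ e) (pair p φ)))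

-- Exchange of two finite sums, by induction on `p`; linearity of `pair q` in its function argument
-- absorbs each term of `p`.
pair-swap : ∀ {m n} (p : Poly m) (q : Poly n) (φ : Monomial m → Monomial n → ℤ) →
  pair p (λ e → pair q (φ e)) ≡ pair q (λ f → pair p (λ e → φ e f))
pair-swap []            q φ = sym (pair-zero q)
pair-swap ((c , e) ∷ p) q φ = trans
  (cong₂ ℤ._+_ (sym (pair-scale q c (φ e))) (pair-swap p q φ))
  (sym (pair-add q _ _))

pair-+ : ∀ {n} (p q : Poly n) φ → pair (p + q) φ ≡ pair p φ ℤ.+ pair q φ
pair-+ []            q φ = sym (ℤ.+-identityˡ _)
pair-+ ((c , e) ∷ p) q φ = trans
  (cong (λ d → c ℤ.* φ e ℤ.+ d) (pair-+ p q φ))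
  (sym (ℤ.+-assoc (c ℤ.* φ e) (pair p φ) (pair q φ)))

pair-neg : ∀ {n} (p : Poly n) φ → pair (- p) φ ≡ ℤ.- pair p φ
pair-neg []            φ = refl
pair-neg ((c , e) ∷ p) φ = trans
  (cong₂ ℤ._+_ (sym (ℤ.neg-distribˡ-* c (φ e))) (pair-neg p φ))
  (sym (ℤ.neg-distrib-+ (c ℤ.* φ e) (pair p φ)))

pair-const : ∀ {n} c φ → pair (const {n} c) φ ≡ c ℤ.* φ (replicate n 0)
pair-const c φ = ℤ.+-identityʳ _

-- The product acts as the convolution of the two functionals. The inner pairing is a general
-- function of `e` even when `φ` is a delta function, which is why all `φ` have to be considered.
pair-* : ∀ {n} (p q : Poly n) φ →
  pair (p * q) φ ≡ pair p (λ e → pair q (λ f → φ (zipWith ℕ._+_ e f)))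
pair-* []            q φ = refl
pair-* ((c , e) ∷ p) q φ =
  trans (pair-+ (map _ q) (p * q) φ) (cong₂ ℤ._+_ (row q) (pair-* p q φ))
  where
  -- The products of the fixed term `(c , e)` with all terms of `q`; `q` is rebound to allow
  -- induction on it alone.
  row : ∀ q → pair (map (λ (d , f) → c ℤ.* d , zipWith ℕ._+_ e f) q) φ ≡
              c ℤ.* pair q (λ f → φ (zipWith ℕ._+_ e f))
  row []            = sym (ℤ.*-zeroʳ c)
  row ((d , f) ∷ q) = trans
    (cong₂ ℤ._+_ (ℤ.*-assoc c d _) (row q))
    (sym (ℤ.*-distribˡ-+ c _ _))

pair-const-* : ∀ {n} c (q : Poly n) φ → pair (const c * q) φ ≡ c ℤ.* pair q φ
pair-const-* c q φ = begin
  pair (const c * q) φ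
    ≡⟨ pair-* (const c) q φ ⟩
  pair (const c) (λ e → pair q (λ f → φ (zipWith ℕ._+_ e f)))
    ≡⟨ pair-const c (λ e → pair q (λ f → φ (zipWith ℕ._+_ e f))) ⟩
  c ℤ.* pair q (λ f → φ (zipWith ℕ._+_ (replicate _ 0) f))
    ≡⟨ cong (c ℤ.*_) (pair-cong q λ f →
         cong φ (Vec.zipWith-identityˡ ℕ.+-identityˡ f)) ⟩
  c ℤ.* pair q φ ∎
  where open ≡-Reasoning

-- Coefficients determine the functional.

δ : ∀ {n} → Monomial n → Monomial n → ℤ
δ m e = if does (e ≟ᵐ m) then ℤ.1ℤ else ℤ.0ℤ

coeff≡pair-δ : ∀ {n} (p : Poly n) m → coeff p m ≡ pair p (δ m)
coeff≡pair-δ []            m = refl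
coeff≡pair-δ ((c , e) ∷ p) m = cong₂ ℤ._+_ (term (e ≟ᵐ m)) (coeff≡pair-δ p m)
  where
  -- Abstracting the decision lets both conditionals reduce together.
  term : ∀ d → (if does d then c else ℤ.0ℤ) ≡ c ℤ.* (if does d then ℤ.1ℤ else ℤ.0ℤ)
  term (yes _) = sym (ℤ.*-identityʳ c)
  term (no  _) = sym (ℤ.*-zeroʳ c)

pair⇒≈ : ∀ {n} (p q : Poly n) → (∀ φ → pair p φ ≡ pair q φ) → p ≈ q
pair⇒≈ p q p≗q m =
  trans (coeff≡pair-δ p m) (trans (p≗q (δ m)) (sym (coeff≡pair-δ q m)))

vanishAt : ∀ {n} → Monomial n → (Monomial n → ℤ) → Monomial n → ℤ
vanishAt s φ e = if does (e ≟ᵐ s) then ℤ.0ℤ else φ e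

-- Isolates the value at `s` as a multiple of a delta function, whose pairing with a polynomial is a
-- coefficient.
vanishAt-split : ∀ {n} s (φ : Monomial n → ℤ) e → φ e ≡ φ s ℤ.* δ s e ℤ.+ vanishAt s φ e
vanishAt-split s φ e with e ≟ᵐ s
... | yes refl = sym (trans (ℤ.+-identityʳ _) (ℤ.*-identityʳ (φ e)))
... | no  _    = sym (trans (cong (ℤ._+ φ e) (ℤ.*-zeroʳ (φ s))) (ℤ.+-identityˡ (φ e)))

-- The outermost reset either hits `e` or passes on the value of the inner function, and then `e`
-- must lie in the tail.
vanishAt-∈ : ∀ {n} {e : Monomial n} {S} → e ∈ S → ∀ φ → foldr vanishAt φ S e ≡ ℤ.0ℤ
vanishAt-∈ {e = e} {s ∷ S} e∈S φ with e ≟ᵐ s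
... | yes _ = refl
vanishAt-∈ (here e≡s)  φ | no e≢s = contradiction e≡s e≢s
vanishAt-∈ (there e∈S) φ | no _   = vanishAt-∈ e∈S φ

pair-vanishing : ∀ {n} (p : Poly n) φ → All (λ t → φ (proj₂ t) ≡ ℤ.0ℤ) p → pair p φ ≡ ℤ.0ℤ
pair-vanishing []            φ []            = refl
pair-vanishing ((c , e) ∷ p) φ (φe≡0 ∷ φp≡0) =
  cong₂ ℤ._+_ (trans (cong (c ℤ.*_) φe≡0) (ℤ.*-zeroʳ c)) (pair-vanishing p φ φp≡0)

-- A zero coefficient at s lets φ be reset to 0 at s without changing the
-- pairing; do this at every exponent occurring in p.
≈0⇒pair≡0 : ∀ {n} (p : Poly n) → p ≈ 0# → ∀ φ → pair p φ ≡ ℤ.0ℤ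
≈0⇒pair≡0 p p≈0 φ = trans (sym (reset (map proj₂ p)))
  (pair-vanishing p _ (All.tabulate λ t∈p → vanishAt-∈ (∈-map⁺ proj₂ t∈p) φ))
  where
  open ≡-Reasoning
  reset₁ : ∀ s ψ → pair p (vanishAt s ψ) ≡ pair p ψ
  reset₁ s ψ = sym (begin
    pair p ψ
      ≡⟨ pair-cong p (vanishAt-split s ψ) ⟩
    pair p (λ e → ψ s ℤ.* δ s e ℤ.+ vanishAt s ψ e)
      ≡⟨ pair-add p _ _ ⟩
    pair p (λ e → ψ s ℤ.* δ s e) ℤ.+ pair p (vanishAt s ψ)
      ≡⟨ cong (ℤ._+ pair p (vanishAt s ψ)) (pair-scale p (ψ s) (δ s)) ⟩
    ψ s ℤ.* pair p (δ s) ℤ.+ pair p (vanishAt s ψ)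
      ≡⟨ cong (λ c → ψ s ℤ.* c ℤ.+ pair p (vanishAt s ψ))
           (trans (sym (coeff≡pair-δ p s)) (p≈0 s)) ⟩
    ψ s ℤ.* ℤ.0ℤ ℤ.+ pair p (vanishAt s ψ)
      ≡⟨ cong (ℤ._+ pair p (vanishAt s ψ)) (ℤ.*-zeroʳ (ψ s)) ⟩
    ℤ.0ℤ ℤ.+ pair p (vanishAt s ψ)
      ≡⟨ ℤ.+-identityˡ _ ⟩
    pair p (vanishAt s ψ) ∎)

  reset : ∀ S → pair p (foldr vanishAt φ S) ≡ pair p φ
  reset []      = refl
  reset (s ∷ S) = trans (reset₁ s (foldr vanishAt φ S)) (reset S)

pair-- : ∀ {n} (p q : Poly n) φ → pair (p - q) φ ≡ pair p φ ℤ.- pair q φ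
pair-- p q φ = trans (pair-+ p (- q) φ) (cong (λ c → pair p φ ℤ.+ c) (pair-neg q φ))

-- Passing to `p - q` reduces the claim to a polynomial with zero coefficients, where a single list
-- of exponents has to be cleared. As the converse of `pair⇒≈`, this makes `_≈_` equality of
-- functionals.
≈⇒pair : ∀ {n} (p q : Poly n) → p ≈ q → ∀ φ → pair p φ ≡ pair q φ
≈⇒pair p q p≈q φ = ℤ.i-j≡0⇒i≡j (pair p φ) (pair q φ)
  (trans (sym (pair-- p q φ)) (≈0⇒pair≡0 (p - q) p-q≈0 φ))
  where
  p-q≈0 : p - q ≈ 0#
  p-q≈0 m = begin
    coeff (p - q) m                      ≡⟨ coeff≡pair-δ (p - q) m ⟩
    pair (p - q) (δ m)                   ≡⟨ pair-- p q (δ m) ⟩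
    pair p (δ m) ℤ.- pair q (δ m)        ≡⟨ cong₂ ℤ._-_ (coeff≡pair-δ p m) (coeff≡pair-δ q m) ⟨
    coeff p m ℤ.- coeff q m              ≡⟨ ℤ.i≡j⇒i-j≡0 (p≈q m) ⟩
    ℤ.0ℤ                                 ∎
    where open ≡-Reasoning

-- The commutative ring of polynomials.

-- Implicit polynomials are often passed explicitly because p ≈ q unfolds to a
-- statement about coeff, from which Agda cannot recover p and q.
*-cong-≈ : ∀ {n} {p p′ q q′ : Poly n} → p ≈ p′ → q ≈ q′ → p * q ≈ p′ * q′
*-cong-≈ {p = p} {p′} {q} {q′} p≈p′ q≈q′ = pair⇒≈ (p * q) (p′ * q′) λ φ → begin
  pair (p * q) φ
    ≡⟨ pair-* p q φ ⟩
  pair p (λ e → pair q (λ f → φ (zipWith ℕ._+_ e f)))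
    ≡⟨ ≈⇒pair p p′ p≈p′ _ ⟩
  pair p′ (λ e → pair q (λ f → φ (zipWith ℕ._+_ e f)))
    ≡⟨ pair-cong p′ (λ e → ≈⇒pair q q′ q≈q′ _) ⟩
  pair p′ (λ e → pair q′ (λ f → φ (zipWith ℕ._+_ e f)))
    ≡⟨ pair-* p′ q′ φ ⟨
  pair (p′ * q′) φ ∎
  where open ≡-Reasoning

*-comm-≈ : ∀ {n} (p q : Poly n) → p * q ≈ q * p
*-comm-≈ p q = pair⇒≈ (p * q) (q * p) λ φ → begin
  pair (p * q) φ
    ≡⟨ pair-* p q φ ⟩
  pair p (λ e → pair q (λ f → φ (zipWith ℕ._+_ e f)))
    ≡⟨ pair-swap p q _ ⟩
  pair q (λ f → pair p (λ e → φ (zipWith ℕ._+_ e f)))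
    ≡⟨ pair-cong q (λ f → pair-cong p λ e → cong φ (Vec.zipWith-comm ℕ.+-comm e f)) ⟩
  pair q (λ f → pair p (λ e → φ (zipWith ℕ._+_ f e)))
    ≡⟨ pair-* q p φ ⟨
  pair (q * p) φ ∎
  where open ≡-Reasoning

*-assoc-≈ : ∀ {n} (p q r : Poly n) → (p * q) * r ≈ p * (q * r)
*-assoc-≈ p q r = pair⇒≈ ((p * q) * r) (p * (q * r)) λ φ → begin
  pair ((p * q) * r) φ
    ≡⟨ pair-* (p * q) r φ ⟩
  pair (p * q) (λ e → pair r (λ g → φ (zipWith ℕ._+_ e g)))
    ≡⟨ pair-* p q _ ⟩
  pair p (λ e → pair q (λ f → pair r (λ g → φ (zipWith ℕ._+_ (zipWith ℕ._+_ e f) g))))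
    ≡⟨ pair-cong p (λ e → pair-cong q λ f → pair-cong r λ g →
         cong φ (Vec.zipWith-assoc ℕ.+-assoc e f g)) ⟩
  pair p (λ e → pair q (λ f → pair r (λ g → φ (zipWith ℕ._+_ e (zipWith ℕ._+_ f g)))))
    ≡⟨ pair-cong p (λ e → pair-* q r _) ⟨
  pair p (λ e → pair (q * r) (λ f → φ (zipWith ℕ._+_ e f)))
    ≡⟨ pair-* p (q * r) φ ⟨
  pair (p * (q * r)) φ ∎
  where open ≡-Reasoning

*-identityˡ-≈ : ∀ {n} (p : Poly n) → 1# * p ≈ p
*-identityˡ-≈ p = pair⇒≈ (1# * p) p λ φ → trans (pair-const-* ℤ.1ℤ p φ) (ℤ.*-identityˡ _)

*-distribʳ-+-≈ : ∀ {n} (p q r : Poly n) → (q + r) * p ≈ q * p + r * p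
*-distribʳ-+-≈ p q r = pair⇒≈ ((q + r) * p) (q * p + r * p) λ φ → begin
  pair ((q + r) * p) φ
    ≡⟨ pair-* (q + r) p φ ⟩
  pair (q + r) (λ e → pair p (λ f → φ (zipWith ℕ._+_ e f)))
    ≡⟨ pair-+ q r _ ⟩
  pair q (λ e → pair p (λ f → φ (zipWith ℕ._+_ e f))) ℤ.+
  pair r (λ e → pair p (λ f → φ (zipWith ℕ._+_ e f)))
    ≡⟨ cong₂ ℤ._+_ (pair-* q p φ) (pair-* r p φ) ⟨
  pair (q * p) φ ℤ.+ pair (r * p) φ
    ≡⟨ pair-+ (q * p) (r * p) φ ⟨
  pair (q * p + r * p) φ ∎
  where open ≡-Reasoning

+-cong-≈ : ∀ {n} {p p′ q q′ : Poly n} → p ≈ p′ → q ≈ q′ → p + q ≈ p′ + q′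
+-cong-≈ {p = p} {p′} {q} {q′} p≈p′ q≈q′ = pair⇒≈ (p + q) (p′ + q′) λ φ → trans (pair-+ p q φ)
  (trans (cong₂ ℤ._+_ (≈⇒pair p p′ p≈p′ φ) (≈⇒pair q q′ q≈q′ φ)) (sym (pair-+ p′ q′ φ)))

+-comm-≈ : ∀ {n} (p q : Poly n) → p + q ≈ q + p
+-comm-≈ p q = pair⇒≈ (p + q) (q + p) λ φ →
  trans (pair-+ p q φ) (trans (ℤ.+-comm (pair p φ) (pair q φ)) (sym (pair-+ q p φ)))

*-distribˡ-+-≈ : ∀ {n} (p q r : Poly n) → p * (q + r) ≈ p * q + p * r
*-distribˡ-+-≈ p q r m = trans (*-comm-≈ p (q + r) m) (trans (*-distribʳ-+-≈ p q r m)
  (+-cong-≈ {p = q * p} {p * q} {r * p} {p * r} (*-comm-≈ q p) (*-comm-≈ r p) m))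

neg-cong-≈ : ∀ {n} {p q : Poly n} → p ≈ q → - p ≈ - q
neg-cong-≈ {p = p} {q} p≈q = pair⇒≈ (- p) (- q) λ φ →
  trans (pair-neg p φ) (trans (cong ℤ.-_ (≈⇒pair p q p≈q φ)) (sym (pair-neg q φ)))

+-inverseˡ-≈ : ∀ {n} (p : Poly n) → - p + p ≈ 0#
+-inverseˡ-≈ p = pair⇒≈ (- p + p) 0# λ φ → trans (pair-+ (- p) p φ)
  (trans (cong (ℤ._+ pair p φ) (pair-neg p φ)) (ℤ.+-inverseˡ (pair p φ)))

≈-isEquivalence : ∀ {n} → IsEquivalence (_≈_ {n})
≈-isEquivalence = record
  { refl  = λ m → refl
  ; sym   = λ p≈q m → sym (p≈q m)
  ; trans = λ p≈q q≈r m → trans (p≈q m) (q≈r m)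
  }

polyCommutativeRing : ℕ → CommutativeRing 0ℓ 0ℓ
polyCommutativeRing n = record
  { Carrier = Poly n
  ; _≈_     = _≈_
  ; _+_     = _+_
  ; _*_     = _*_
  ; -_      = -_
  ; 0#      = 0#
  ; 1#      = 1#
  ; isCommutativeRing = record
    { isRing = record
      { +-isAbelianGroup = record
        { isGroup = record
          { isMonoid = record
            { isSemigroup = record
              { isMagma = record
                { isEquivalence = ≈-isEquivalence
                ; ∙-cong        = λ {p} {p′} {q} {q′} → +-cong-≈ {p = p} {p′} {q} {q′}
                }
              -- Addition is concatenation, so associativity and the identity laws already hold as
              -- equalities of lists.
              ; assoc = λ p q r m → cong (λ p → coeff p m) (++-assoc p q r)
              }
            ; identity = (λ p m → refl) , (λ p m → cong (λ p → coeff p m) (++-identityʳ p))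
            }
          ; inverse  = +-inverseˡ-≈ , λ p m → trans (+-comm-≈ p (- p) m) (+-inverseˡ-≈ p m)
          ; ⁻¹-cong  = λ {p} {q} → neg-cong-≈ {p = p} {q}
          }
        ; comm = +-comm-≈
        }
      ; *-cong     = λ {p} {p′} {q} {q′} → *-cong-≈ {p = p} {p′} {q} {q′}
      ; *-assoc    = *-assoc-≈
      ; *-identity = *-identityˡ-≈ , λ p m → trans (*-comm-≈ p 1# m) (*-identityˡ-≈ p m)
      ; distrib    = *-distribˡ-+-≈ , *-distribʳ-+-≈
      }
    ; *-comm = *-comm-≈
    }
  }

-- Substitution as a ring homomorphism.

module PolyRing {n} = CommutativeRing (polyCommutativeRing n)
module PolyLemmas {n} = CommutativeRingLemmas (polyCommutativeRing n)
open PolyLemmas using (monomial; monomial-cong; monomial-+; monomial-0; monomial-unit)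

-- Substitution is linear in `p`, so it acts on functionals by replacing each exponent with the
-- functional of its monomial in `σ`. The right-hand side sees `p` only through its functional,
-- whence substitution respects `_≈_`.
pair-[] : ∀ {m n} (p : Poly m) (σ : Vector (Poly n) m) φ →
          pair (p [ σ ]) φ ≡ pair p (λ e → pair (monomial σ e) φ)
pair-[] []            σ φ = refl
pair-[] ((c , e) ∷ p) σ φ = trans
  (pair-+ (const c * monomial σ e) (p [ σ ]) φ)
  (cong₂ ℤ._+_ (pair-const-* c (monomial σ e) φ) (pair-[] p σ φ))

module _ {m n} (σ : Vector (Poly n) m) where

  open RingMorphisms (PolyRing.rawRing {m}) (PolyRing.rawRing {n})

  []-cong : ∀ p q → p ≈ q → p [ σ ] ≈ q [ σ ]
  []-cong p q p≈q = pair⇒≈ (p [ σ ]) (q [ σ ]) λ φ →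
    trans (pair-[] p σ φ) (trans (≈⇒pair p q p≈q _) (sym (pair-[] q σ φ)))

  []-+ : ∀ p q → (p + q) [ σ ] ≈ p [ σ ] + q [ σ ]
  []-+ p q = pair⇒≈ ((p + q) [ σ ]) (p [ σ ] + q [ σ ]) λ φ → begin
    pair ((p + q) [ σ ]) φ
      ≡⟨ pair-[] (p + q) σ φ ⟩
    pair (p + q) (λ e → pair (monomial σ e) φ)
      ≡⟨ pair-+ p q _ ⟩
    pair p (λ e → pair (monomial σ e) φ) ℤ.+ pair q (λ e → pair (monomial σ e) φ)
      ≡⟨ cong₂ ℤ._+_ (pair-[] p σ φ) (pair-[] q σ φ) ⟨
    pair (p [ σ ]) φ ℤ.+ pair (q [ σ ]) φ
      ≡⟨ pair-+ (p [ σ ]) (q [ σ ]) φ ⟨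
    pair (p [ σ ] + q [ σ ]) φ ∎
    where open ≡-Reasoning

  []-* : ∀ p q → (p * q) [ σ ] ≈ p [ σ ] * q [ σ ]
  []-* p q = pair⇒≈ ((p * q) [ σ ]) (p [ σ ] * q [ σ ]) λ φ → begin
    pair ((p * q) [ σ ]) φ
      ≡⟨ pair-[] (p * q) σ φ ⟩
    pair (p * q) (λ e → pair (monomial σ e) φ)
      ≡⟨ pair-* p q _ ⟩
    pair p (λ e → pair q (λ f → pair (monomial σ (zipWith ℕ._+_ e f)) φ))
      ≡⟨ pair-cong p (λ e → pair-cong q λ f → trans
           (≈⇒pair (monomial σ (zipWith ℕ._+_ e f)) (monomial σ e * monomial σ f)
             (monomial-+ σ e f) φ)
           (pair-* (monomial σ e) (monomial σ f) φ)) ⟩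
    pair p (λ e → pair q (λ f → pair (monomial σ e) (λ e′ → pair (monomial σ f) (λ f′ →
      φ (zipWith ℕ._+_ e′ f′)))))
      -- The sum over `monomial σ e` has to move outside the sum over `q` before the two inner sums
      -- can be folded into `q [ σ ]`.
      ≡⟨ pair-cong p (λ e → pair-swap q (monomial σ e) λ f e′ →
           pair (monomial σ f) (λ f′ → φ (zipWith ℕ._+_ e′ f′))) ⟩
    pair p (λ e → pair (monomial σ e) (λ e′ → pair q (λ f → pair (monomial σ f) (λ f′ →
      φ (zipWith ℕ._+_ e′ f′)))))
      ≡⟨ pair-cong p (λ e → pair-cong (monomial σ e) λ e′ → pair-[] q σ _) ⟨
    pair p (λ e → pair (monomial σ e) (λ e′ → pair (q [ σ ]) (λ f′ →
      φ (zipWith ℕ._+_ e′ f′))))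
      ≡⟨ pair-[] p σ _ ⟨
    pair (p [ σ ]) (λ e′ → pair (q [ σ ]) (λ f′ → φ (zipWith ℕ._+_ e′ f′)))
      ≡⟨ pair-* (p [ σ ]) (q [ σ ]) φ ⟨
    pair (p [ σ ] * q [ σ ]) φ ∎
    where open ≡-Reasoning

  []-neg : ∀ p → (- p) [ σ ] ≈ - (p [ σ ])
  []-neg p = pair⇒≈ ((- p) [ σ ]) (- (p [ σ ])) λ φ → begin
    pair ((- p) [ σ ]) φ                          ≡⟨ pair-[] (- p) σ φ ⟩
    pair (- p) (λ e → pair (monomial σ e) φ)      ≡⟨ pair-neg p _ ⟩
    ℤ.- pair p (λ e → pair (monomial σ e) φ)      ≡⟨ cong ℤ.-_ (pair-[] p σ φ) ⟨
    ℤ.- pair (p [ σ ]) φ                          ≡⟨ pair-neg (p [ σ ]) φ ⟨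
    pair (- (p [ σ ])) φ                          ∎
    where open ≡-Reasoning

  []-1 : 1# [ σ ] ≈ 1#
  []-1 = PolyLemmas.1*x+0≈y {x = monomial σ (replicate m 0)} {1#} (monomial-0 σ)

  []-X : ∀ i → X i [ σ ] ≈ σ i
  []-X i = PolyLemmas.1*x+0≈y {x = monomial σ (replicate m 0 [ i ]≔ 1)} {σ i} (monomial-unit σ i)

  []-isRingHomomorphism : IsRingHomomorphism _[ σ ]
  []-isRingHomomorphism = record
    { isSemiringHomomorphism = record
      { isNearSemiringHomomorphism = record
        { +-isMonoidHomomorphism = record
          { isMagmaHomomorphism = record
            { isRelHomomorphism = record { cong = λ {p} {q} → []-cong p q }
            ; homo              = []-+
            }
          ; ε-homo = λ m → refl
          }
        ; *-homo = []-*
        }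
      ; 1#-homo = []-1
      }
    ; -‿homo = []-neg
    }

  open RingHomomorphism (polyCommutativeRing m) (polyCommutativeRing n)

  monomial-[] : ∀ {l} (ρ : Vector (Poly m) l) e →
                monomial ρ e [ σ ] ≈ monomial (λ i → ρ i [ σ ]) e
  monomial-[] = monomial-homo []-isRingHomomorphism

  [X-1]-[] : ∀ i → (X i - 1#) [ σ ] ≈ σ i - 1#
  [X-1]-[] i = x-1-homo []-isRingHomomorphism {X i} {σ i} ([]-X i)

  -- For `W`, `i` and `j` are the embeddings of the two blocks of variables.
  sum-of-products-[] : ∀ {A : Set} {k} (i j : Fin k → Fin m) (a b : A → Fin k → ℕ) zs →
    sumList (map (λ z → product (λ l → X (i l) ^ a z l * X (j l) ^ b z l)) zs) [ σ ] ≈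
    sumList (map (λ z → product (λ l → σ (i l) ^ a z l * σ (j l) ^ b z l)) zs)
  sum-of-products-[] i j a b = sum-of-products-homo []-isRingHomomorphism
    {x = X ∘ i} {X ∘ j} {σ ∘ i} {σ ∘ j} {a} {b} ([]-X ∘ i) ([]-X ∘ j)

[]-congʳ : ∀ {m n} (p : Poly m) (σ τ : Vector (Poly n) m) →
           (∀ i → σ i ≈ τ i) → p [ σ ] ≈ p [ τ ]
[]-congʳ p σ τ σ≈τ = pair⇒≈ (p [ σ ]) (p [ τ ]) λ φ → trans (pair-[] p σ φ) (trans
  (pair-cong p λ e → ≈⇒pair (monomial σ e) (monomial τ e) (monomial-cong {x = σ} {τ} σ≈τ e) φ)
  (sym (pair-[] p τ φ)))

-- Since substituting `σ` is a ring homomorphism, it carries each monomial in `ρ` to the same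
-- monomial in the substituted entries. This is needed because `T` is itself a substitution into
-- `W`.
[]-[] : ∀ {l m n} (p : Poly l) (ρ : Vector (Poly m) l) (σ : Vector (Poly n) m) →
        p [ ρ ] [ σ ] ≈ p [ (λ i → ρ i [ σ ]) ]
[]-[] p ρ σ = pair⇒≈ (p [ ρ ] [ σ ]) (p [ (λ i → ρ i [ σ ]) ]) λ φ → begin
  pair (p [ ρ ] [ σ ]) φ
    ≡⟨ pair-[] (p [ ρ ]) σ φ ⟩
  pair (p [ ρ ]) (λ e → pair (monomial σ e) φ)
    ≡⟨ pair-[] p ρ _ ⟩
  pair p (λ e → pair (monomial ρ e) (λ f → pair (monomial σ f) φ))
    ≡⟨ pair-cong p (λ e → trans
         (sym (pair-[] (monomial ρ e) σ φ))
         (≈⇒pair (monomial ρ e [ σ ]) (monomial (λ i → ρ i [ σ ]) e) (monomial-[] σ ρ e) φ)) ⟩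
  pair p (λ e → pair (monomial (λ i → ρ i [ σ ]) e) φ)
    ≡⟨ pair-[] p (λ i → ρ i [ σ ]) φ ⟨
  pair (p [ (λ i → ρ i [ σ ]) ]) φ ∎
  where open ≡-Reasoning

-- Chain polynomials of a matroid.

module _ {n} (M : Matroid n) where
  open Matroid M

  corank nullity : Subset n → ℕ
  corank  A = rank ∸ rk A
  nullity A = ∣ A ∣ ∸ rk A

  -- Monotonicity and boundedness of the rank make both truncated subtractions exact; each side is
  -- then twice the corank plus the nullity plus `rk A`.
  rank+corank+nullity : ∀ A →
    rank ℕ.+ (corank A ℕ.+ nullity A) ≡ ∣ A ∣ ℕ.+ (corank A ℕ.+ corank A)
  rank+corank+nullity A = begin
    rank ℕ.+ (corank A ℕ.+ nullity A)
      ≡⟨ cong (ℕ._+ (corank A ℕ.+ nullity A)) (ℕ.m∸n+n≡m (rk-monotone (⊆-max A))) ⟨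
    (corank A ℕ.+ rk A) ℕ.+ (corank A ℕ.+ nullity A)
      ≡⟨ solve 3 (λ a b c → (a :+ c) :+ (a :+ b) := (b :+ c) :+ (a :+ a)) refl
           (corank A) (nullity A) (rk A) ⟩
    (nullity A ℕ.+ rk A) ℕ.+ (corank A ℕ.+ corank A)
      ≡⟨ cong (ℕ._+ (corank A ℕ.+ corank A)) (ℕ.m∸n+n≡m (rk-bounded A)) ⟩
    ∣ A ∣ ℕ.+ (corank A ℕ.+ corank A) ∎
    where
    open ≡-Reasoning
    open +-*-Solver

  module _ (k : ℕ) where

    W-point T-point : Vector (Poly k) (k ℕ.+ k)
    W-point = (λ i → - X i) ++ (λ (i : Fin k) → - 1#)
    T-point = (λ i → 1# - X i) ++ (λ (i : Fin k) → 0#)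

    signed : Poly k → Poly k
    signed p = (- 1#) ^ (k ℕ.* rank) * p

    -- Evaluating `W` replaces the variables inside each chain's product; distributing the sign over
    -- the k factors then turns each of them into the corresponding factor of `χ`.
    signed-W≈χ : signed (W M k [ W-point ]) ≈ χ M k
    signed-W≈χ = PolyRing.trans {i = signed (W M k [ W-point ])} {signed W-value} {χ M k}
      (PolyRing.*-congˡ {x = (- 1#) ^ (k ℕ.* rank)} {W M k [ W-point ]} {W-value}
        (sum-of-products-[] W-point (_↑ˡ k) (k ↑ʳ_)
          (λ S i → corank (lookup S i)) (λ S i → nullity (lookup S i)) (chains n k)))
      (PolyLemmas.sum-of-products-signs
        {u = λ i → W-point (i ↑ˡ k)} {λ i → W-point (k ↑ʳ i)} {X}
        {λ S i → corank (lookup S i)} {λ S i → nullity (lookup S i)} {λ S i → ∣ lookup S i ∣} {rank}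
        (λ i → PolyRing.reflexive (lookup-++ˡ (λ i → - X i) (λ (i : Fin k) → - 1#) i))
        (λ i → PolyRing.reflexive (lookup-++ʳ (λ i → - X i) (λ (i : Fin k) → - 1#) i))
        (λ S i → rank+corank+nullity (lookup S i))
        (chains n k))
      where
      W-value : Poly k
      W-value = ∑-chains λ S → product λ i →
        W-point (i ↑ˡ k) ^ corank (lookup S i) * W-point (k ↑ʳ i) ^ nullity (lookup S i)

    -- `T` is `W` with every variable lowered by 1, and lowering 1 - t and 0 by 1 gives -t and -1.
    -- The two successive substitutions therefore compose to `W-point`.
    W≈T : W M k [ W-point ] ≈ T M k [ T-point ]
    W≈T m = sym (trans ([]-[] (W M k) shift T-point m)
      ([]-congʳ (W M k) (λ i → shift i [ T-point ]) W-point shift[T-point] m))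
      where
      shift : Vector (Poly (k ℕ.+ k)) (k ℕ.+ k)
      shift = (λ i → X (i ↑ˡ k) - 1#) ++ (λ i → X (k ↑ʳ i) - 1#)

      shift[T-point] : ∀ i → shift i [ T-point ] ≈ W-point i
      -- Concatenation branches on `splitAt`, so this split reduces both `shift i` and `W-point i`;
      -- `T-point` is met at an embedded index and needs the lookup lemmas.
      shift[T-point] i with splitAt k i
      ... | inj₁ j = λ m → trans ([X-1]-[] T-point (j ↑ˡ k) m) (trans
        (cong (λ p → coeff (p - 1#) m) (lookup-++ˡ (λ i → 1# - X i) (λ (i : Fin k) → 0#) j))
        (PolyLemmas.[x-y]-x≈-y 1# (X j) m))
      -- No ring law is needed at the end: `0# - 1#` computes to `- 1#`, because `0#` is the empty
      -- list.
      ... | inj₂ j = λ m → trans ([X-1]-[] T-point (k ↑ʳ j) m)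
        (cong (λ p → coeff (p - 1#) m) (lookup-++ʳ (λ i → 1# - X i) (λ (i : Fin k) → 0#) j))

theorem1p4 : ∀ {n : ℕ} (M : Matroid n) (k : ℕ) → 1 ℕ.≤ k →
    let r = Matroid.rank M
        t = X {k}
    in
    (χ M k ≈ (- 1#) ^ (k ℕ.* r) * W M k [ (λ i → - t i) ++ (λ (i : Fin k) → - 1#) ])
    × ((- 1#) ^ (k ℕ.* r) * W M k [ (λ i → - t i) ++ (λ (i : Fin k) → - 1#) ]
        ≈ (- 1#) ^ (k ℕ.* r) * T M k [ (λ i → 1# - t i) ++ (λ (i : Fin k) → 0#) ])
theorem1p4 M k _ =
  (λ m → sym (signed-W≈χ M k m)) ,
  PolyRing.*-congˡ {x = (- 1#) ^ (k ℕ.* Matroid.rank M)}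
    {W M k [ W-point M k ]} {T M k [ T-point M k ]} (W≈T M k)
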